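{- Let $\mathbf{P}=\{p_n(x)\}_{n\ge0}$ be a sequence of complex polynomials with $\deg p_n=n$, $p_0=1$, and let $\bar{\mathbf{P}}=\{\bar p_n(x)\}$ with $\bar p_0(x)=1$, $\bar p_n(x)=xp_{n-1}(x)$ for $n\ge1$. Then for $n\ge2$ and $1\le k\le n-1$, $$A_{n,k}(\bar{\mathbf{P}})=(k+1)A_{n-1,k}(\mathbf{P})+(n-k)A_{n-1,k-1}(\mathbf{P}),$$ and for $n\ge1$, $A_{n,0}(\bar{\mathbf{P}})=\bar p_n(1)=A_{n-1,0}(\mathbf{P})=p_{n-1}(1)$.
   Context: For any sequence $\mathbf{Q}=\{q_n\}$ with $\deg q_n=n$, $q_0=1$, the Eulerian numbers $A_{n,k}(\mathbf{Q})$ ($0\le k\le n$) are the unique coefficients with $q_n(x)=\sum_{k=0}^{n}A_{n,k}(\mathbf{Q})\binom{x+n-k-1}{n}$, where $\binom{y}{n}=y(y-1)\cdots(y-n+1)/n!$. -}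

module Defs where

open import Level using (_⊔_)
open import Algebra.Apartness.Bundles using (HeytingField; HeytingCommutativeRing)
open import Algebra.Bundles using (module CommutativeRing)
open import Data.List.Base using (List; []; _∷_; map; foldr; applyUpTo)
open import Data.Nat.Base as ℕ using (ℕ; zero; suc; s≤s; NonZero; _!)
open import Data.Nat.Properties using (_!≢0)
open import Data.Product.Base using (_×_; _,_; proj₁)
import Algebra.Apartness.Properties.HeytingCommutativeRing as HeytingProperties
import Algebra.Properties.Semiring.Mult as SemiringMult

-- The complex numbers are replaced by an arbitrary Heyting field of
-- characteristic zero.  Its apartness _#_ expresses "different from"; a
-- classical field is the case where x # y means ¬ (x ≈ y).

module _ {c ℓ₁ ℓ₂} (F : HeytingField c ℓ₁ ℓ₂) where
  open HeytingField F
  open HeytingCommutativeRing heytingCommutativeRing using (commutativeRing)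
  open SemiringMult (CommutativeRing.semiring commutativeRing)
    using () renaming (_×_ to _·ℕ_)

  fromℕ : ℕ → Carrier
  fromℕ n = n ·ℕ 1#

  CharacteristicZero : Set ℓ₂
  CharacteristicZero = ∀ n → .{{NonZero n}} → fromℕ n # 0#

module Eulerian {c ℓ₁ ℓ₂} (F : HeytingField c ℓ₁ ℓ₂) (char0 : CharacteristicZero F) where
  open HeytingField F
  open HeytingProperties heytingCommutativeRing using (1#0; #-congʳ)

  ι : ℕ → Carrier
  ι = fromℕ F

  -- Coefficient lists, constant term first; trailing zeros are allowed, so
  -- equality is _≈ₚ_ and the degree is given by HasDegree.

  Poly : Set c
  Poly = List Carrier

  coeff : Poly → ℕ → Carrier
  coeff []      _       = 0#
  coeff (a ∷ p) zero    = a
  coeff (a ∷ p) (suc i) = coeff p i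

  infix 4 _≈ₚ_
  _≈ₚ_ : Poly → Poly → Set ℓ₁
  p ≈ₚ q = ∀ i → coeff p i ≈ coeff q i

  HasDegree : Poly → ℕ → Set (ℓ₁ ⊔ ℓ₂)
  HasDegree p n = coeff p n # 0# × (∀ i → n ℕ.< i → coeff p i ≈ 0#)

  infixl 6 _+ₚ_
  infixl 7 _*ₚ_
  infixr 8 _•_

  _+ₚ_ : Poly → Poly → Poly
  []      +ₚ q       = q
  (a ∷ p) +ₚ []      = a ∷ p
  (a ∷ p) +ₚ (b ∷ q) = (a + b) ∷ (p +ₚ q)

  _•_ : Carrier → Poly → Poly
  a • p = map (a *_) p

  _*ₚ_ : Poly → Poly → Poly
  []      *ₚ q = []
  (a ∷ p) *ₚ q = a • q +ₚ (0# ∷ p *ₚ q)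

  const : Carrier → Poly
  const a = a ∷ []

  0ₚ 1ₚ X : Poly
  0ₚ = []
  1ₚ = const 1#
  X  = 0# ∷ 1# ∷ []

  eval : Poly → Carrier → Carrier
  eval p x = foldr (λ a r → a + x * r) 0# p

  factorial⁻¹ : ℕ → Carrier
  factorial⁻¹ n = proj₁ (#⇒invertible (char0 (n !) {{n !≢0}}))

  -- y (y - 1) ⋯ (y - n + 1) / n!
  binomial : Poly → ℕ → Poly
  binomial y n = factorial⁻¹ n • foldr _*ₚ_ 1ₚ (applyUpTo (λ i → y +ₚ const (- ι i)) n)

  -- binom(x + n - k - 1, n)
  basis : ℕ → ℕ → Poly
  basis n k = binomial (X +ₚ const (ι n - ι k - 1#)) n

  record PolynomialSequence : Set (c ⊔ ℓ₁ ⊔ ℓ₂) where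
    field
      poly   : ℕ → Poly
      degree : ∀ n → HasDegree (poly n) n
      poly₀  : poly 0 ≈ₚ 1ₚ

  open PolynomialSequence public

  -- A n k is the Eulerian number A_{n,k}(Q).  Only the entries with k ≤ n are
  -- constrained (and these are determined by Q); the others are junk values.
  IsEulerian : PolynomialSequence → (ℕ → ℕ → Carrier) → Set ℓ₁
  IsEulerian Q A =
    ∀ n → poly Q n ≈ₚ foldr _+ₚ_ 0ₚ (applyUpTo (λ k → A n k • basis n k) (suc n))

  private
    coeff-+ : ∀ p q i → coeff (p +ₚ q) i ≈ coeff p i + coeff q i
    coeff-+ []      q       i       = sym (+-identityˡ _)
    coeff-+ (a ∷ p) []      i       = sym (+-identityʳ _)
    coeff-+ (a ∷ p) (b ∷ q) zero    = refl
    coeff-+ (a ∷ p) (b ∷ q) (suc i) = coeff-+ p q i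

    coeff-• : ∀ a p i → coeff (a • p) i ≈ a * coeff p i
    coeff-• a []      i       = sym (zeroʳ a)
    coeff-• a (b ∷ p) zero    = refl
    coeff-• a (b ∷ p) (suc i) = coeff-• a p i

    coeff-0 : ∀ i → coeff (0# ∷ []) i ≈ 0#
    coeff-0 zero    = refl
    coeff-0 (suc i) = refl

    coeff-X* : ∀ p i → coeff (X *ₚ p) (suc i) ≈ coeff p i
    coeff-X* p i = trans (coeff-+ (0# • p) _ (suc i))
      (trans (+-cong (trans (coeff-• 0# p (suc i)) (zeroˡ _))
                     (trans (coeff-+ (1# • p) (0# ∷ []) i)
                            (trans (+-cong (trans (coeff-• 1# p i) (*-identityˡ _)) (coeff-0 i))
                                   (+-identityʳ _))))
             (+-identityˡ _))

  bar : PolynomialSequence → PolynomialSequence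
  bar P = record { poly = p̄ ; degree = deg ; poly₀ = λ _ → refl }
    where
    p̄ : ℕ → Poly
    p̄ zero    = 1ₚ
    p̄ (suc n) = X *ₚ poly P n

    deg : ∀ n → HasDegree (p̄ n) n
    deg zero    = 1#0 , λ where (suc _) _ → refl
    deg (suc n) with degree P n
    ... | lead , above =
      #-congʳ (sym (coeff-X* (poly P n) n)) lead ,
      λ where (suc i) (s≤s n<i) → trans (coeff-X* (poly P n) i) (above i n<i)

{-# OPTIONS --safe #-}

-- The basis polynomials B n k = binom(x + n - k - 1, n) satisfy
--   x · B m k = (k + 1) B (m + 1) k + (m - k) B (m + 1) (k + 1),
-- so multiplying the Eulerian expansion of p_m by x yields an expansion of
-- x p_m whose coefficients are given by the claimed recurrence.  At the points
-- 1, 2, …, n + 1 the matrix of values of B n 0, …, B n n is unitriangular,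
-- which makes the coefficients unique; its first row, the values at 1, gives
-- A_{n,0} = q_n(1).

module Submission where

open import Defs
open import Algebra.Apartness.Bundles using (HeytingField; HeytingCommutativeRing)
open import Algebra.Bundles using (CommutativeRing)
open import Data.Fin.Base using (toℕ)
open import Data.Fin.Properties using (toℕ<n; toℕ-fromℕ; toℕ-inject₁)
open import Data.List.Base using ([]; _∷_; foldr; applyUpTo)
open import Data.Nat.Base as ℕ using (ℕ; zero; suc; _∸_; _≤_; _<_; s≤s; z≤n; z<s; s<s; s<s⁻¹; s≤s⁻¹; _!)
import Data.Nat.Properties as ℕₚ
open import Data.Product.Base using (_×_; _,_; proj₁; proj₂)
open import Function.Base using (_∘_)
import Relation.Binary.PropositionalEquality.Core as ≡
import Algebra.Apartness.Properties.HeytingCommutativeRing as HeytingProperties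
import Algebra.Properties.Ring as RingProperties
import Algebra.Properties.Semiring.Mult as SemiringMult
import Algebra.Properties.Semiring.Sum as SemiringSum
import Algebra.Solver.Ring.NaturalCoefficients.Default as NaturalSolver
import Relation.Binary.Reasoning.Setoid as SetoidReasoning

module _ {c ℓ₁ ℓ₂} (F : HeytingField c ℓ₁ ℓ₂) (char0 : CharacteristicZero F) where
  open HeytingField F
  open Eulerian F char0
  open HeytingCommutativeRing heytingCommutativeRing using (commutativeRing)
  open CommutativeRing commutativeRing using (ring; semiring; commutativeSemiring)
  open HeytingProperties heytingCommutativeRing using (x-0≈x)
  open RingProperties ring
    using (+-cancelˡ; +-cancelʳ; -‿+-comm; //-rightDividesˡ; //-rightDividesʳ)
  open SemiringMult semiring using (×-homo-+; ×1-homo-*; ×-homo-1)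
  open SemiringSum semiring
    using (sum-syntax; sum-cong-≋; sum-replicate-zero; sum-init-last; ∑-distrib-+; *-distribˡ-sum)
  open NaturalSolver commutativeSemiring using (solve; _:=_; _:+_; _:*_; con)
  open SetoidReasoning setoid

  -- Natural numbers in the field and finite sums.

  ι-+ : ∀ m n → ι (m ℕ.+ n) ≈ ι m + ι n
  ι-+ = ×-homo-+ 1#

  -- Sums unfold at their first term by definition; the split at the last term serves to drop the
  -- top term of an expansion.
  ∑-snoc : ∀ n (f : ℕ → Carrier) → ∑[ i < suc n ] f (toℕ i) ≈ ∑[ i < n ] f (toℕ i) + f n
  ∑-snoc n f = trans (sum-init-last (f ∘ toℕ {suc n}))
    (+-cong (sum-cong-≋ {n} λ i → reflexive (≡.cong f (toℕ-inject₁ i)))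
            (reflexive (≡.cong f (toℕ-fromℕ n))))

  -- Evaluation of polynomials at a point.

  eval-≈[] : ∀ p x → p ≈ₚ [] → eval p x ≈ 0#
  eval-≈[] []      x p≈[] = refl
  eval-≈[] (a ∷ p) x p≈[] = begin
    a + x * eval p x  ≈⟨ +-cong (p≈[] 0) (*-congˡ (eval-≈[] p x (p≈[] ∘ suc))) ⟩
    0# + x * 0#       ≈⟨ +-identityˡ _ ⟩
    x * 0#            ≈⟨ zeroʳ x ⟩
    0#                ∎

  -- Equal polynomials may be lists of different lengths, the excess consisting of zeros; `eval-≈[]`
  -- disposes of that excess.
  eval-cong : ∀ p q x → p ≈ₚ q → eval p x ≈ eval q x
  eval-cong p       []      x p≈q = eval-≈[] p x p≈q
  eval-cong []      (b ∷ q) x p≈q = sym (eval-≈[] (b ∷ q) x (sym ∘ p≈q))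
  eval-cong (a ∷ p) (b ∷ q) x p≈q = +-cong (p≈q 0) (*-congˡ (eval-cong p q x (p≈q ∘ suc)))

  eval-congʳ : ∀ p {x y} → x ≈ y → eval p x ≈ eval p y
  eval-congʳ []      x≈y = refl
  eval-congʳ (a ∷ p) x≈y = +-congˡ (*-cong x≈y (eval-congʳ p x≈y))

  eval-+ : ∀ p q x → eval (p +ₚ q) x ≈ eval p x + eval q x
  eval-+ []      q       x = sym (+-identityˡ _)
  eval-+ (a ∷ p) []      x = sym (+-identityʳ _)
  eval-+ (a ∷ p) (b ∷ q) x = begin
    (a + b) + x * eval (p +ₚ q) x              ≈⟨ +-congˡ (*-congˡ (eval-+ p q x)) ⟩
    (a + b) + x * (eval p x + eval q x)
      ≈⟨ solve 5 (λ a b x u v → (a :+ b) :+ x :* (u :+ v) := (a :+ x :* u) :+ (b :+ x :* v))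
               refl a b x (eval p x) (eval q x) ⟩
    (a + x * eval p x) + (b + x * eval q x)    ∎

  eval-• : ∀ a p x → eval (a • p) x ≈ a * eval p x
  eval-• a []      x = sym (zeroʳ a)
  eval-• a (b ∷ p) x = begin
    a * b + x * eval (a • p) x    ≈⟨ +-congˡ (*-congˡ (eval-• a p x)) ⟩
    a * b + x * (a * eval p x)
      ≈⟨ solve 4 (λ a b x u → a :* b :+ x :* (a :* u) := a :* (b :+ x :* u)) refl a b x (eval p x) ⟩
    a * (b + x * eval p x)        ∎

  eval-* : ∀ p q x → eval (p *ₚ q) x ≈ eval p x * eval q x
  eval-* []      q x = sym (zeroˡ _)
  eval-* (a ∷ p) q x = begin
    eval (a • q +ₚ (0# ∷ p *ₚ q)) x                ≈⟨ eval-+ (a • q) _ x ⟩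
    eval (a • q) x + (0# + x * eval (p *ₚ q) x)
      ≈⟨ +-cong (eval-• a q x) (trans (+-identityˡ _) (*-congˡ (eval-* p q x))) ⟩
    a * eval q x + x * (eval p x * eval q x)
      ≈⟨ solve 4 (λ a x u v → a :* v :+ x :* (u :* v) := (a :+ x :* u) :* v)
               refl a x (eval p x) (eval q x) ⟩
    (a + x * eval p x) * eval q x                  ∎

  eval-const : ∀ a x → eval (const a) x ≈ a
  eval-const a x = trans (+-congˡ (zeroʳ x)) (+-identityʳ a)

  eval-X : ∀ x → eval X x ≈ x
  eval-X x = begin
    0# + x * eval (const 1#) x  ≈⟨ +-identityˡ _ ⟩
    x * eval (const 1#) x       ≈⟨ *-congˡ (eval-const 1# x) ⟩
    x * 1#                      ≈⟨ *-identityʳ x ⟩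
    x                           ∎

  eval-∑ : ∀ (p : ℕ → Poly) n x →
    eval (foldr _+ₚ_ 0ₚ (applyUpTo p n)) x ≈ ∑[ i < n ] eval (p (toℕ i)) x
  eval-∑ p zero    x = refl
  eval-∑ p (suc n) x = trans (eval-+ (p 0) _ x) (+-congˡ (eval-∑ (p ∘ suc) n x))

  -- Falling factorials.

  -- The product y (y - 1) ... (y - n + 1). Shifting the base at each step lets inductions at
  -- `y = ι a` descend from `suc a` to `a`.
  falling : Carrier → ℕ → Carrier
  falling y zero    = 1#
  falling y (suc n) = y * falling (y - 1#) n

  falling-cong : ∀ {y z} n → y ≈ z → falling y n ≈ falling z n
  falling-cong zero    y≈z = refl
  falling-cong (suc n) y≈z = *-cong y≈z (falling-cong n (+-congʳ y≈z))

  y-ι[1+n]≈y-1-ιn : ∀ y n → y - ι (suc n) ≈ y - 1# - ι n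
  y-ι[1+n]≈y-1-ιn y n = trans (+-congˡ (sym (-‿+-comm 1# (ι n)))) (sym (+-assoc y _ _))

  -- In `falling-recurrence` the two products of length m + 1 extend the same product of length m at
  -- opposite ends, so the last factor must be accessible too.
  falling-snoc : ∀ y n → falling y (suc n) ≈ falling y n * (y - ι n)
  falling-snoc y zero    = trans (*-comm y 1#) (*-congˡ (sym (x-0≈x y)))
  falling-snoc y (suc n) = begin
    y * falling (y - 1#) (suc n)                ≈⟨ *-congˡ (falling-snoc (y - 1#) n) ⟩
    y * (falling (y - 1#) n * (y - 1# - ι n))   ≈⟨ *-assoc y _ _ ⟨
    y * falling (y - 1#) n * (y - 1# - ι n)     ≈⟨ *-congˡ (y-ι[1+n]≈y-1-ιn y n) ⟨
    y * falling (y - 1#) n * (y - ι (suc n))    ∎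

  ι[1+a]-1≈ιa : ∀ a → ι (suc a) - 1# ≈ ι a
  ι[1+a]-1≈ιa a = trans (+-congʳ (+-comm 1# (ι a))) (//-rightDividesʳ 1# (ι a))

  -- Since a < n, the factors a, a - 1, ... reach zero before the product ends.
  falling-ι-vanish : ∀ {a n} → a < n → falling (ι a) n ≈ 0#
  falling-ι-vanish {zero}  {suc n} _   = zeroˡ _
  falling-ι-vanish {suc a} {suc n} a<n = begin
    ι (suc a) * falling (ι (suc a) - 1#) n  ≈⟨ *-congˡ (falling-cong n (ι[1+a]-1≈ιa a)) ⟩
    ι (suc a) * falling (ι a) n             ≈⟨ *-congˡ (falling-ι-vanish (s<s⁻¹ a<n)) ⟩
    ι (suc a) * 0#                       ≈⟨ zeroʳ _ ⟩
    0#                                   ∎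

  falling-ι-diag : ∀ n → falling (ι n) n ≈ ι (n !)
  falling-ι-diag zero    = sym (×-homo-1 1#)
  falling-ι-diag (suc n) = begin
    ι (suc n) * falling (ι (suc n) - 1#) n  ≈⟨ *-congˡ (falling-cong n (ι[1+a]-1≈ιa n)) ⟩
    ι (suc n) * falling (ι n) n             ≈⟨ *-congˡ (falling-ι-diag n) ⟩
    ι (suc n) * ι (n !)                  ≈⟨ ×1-homo-* (suc n) (n !) ⟨
    ι (suc n !)                          ∎

  -- An arbitrary family of factors is allowed so that the induction can pass to `p ∘ suc` with base
  -- `y - 1#`.
  eval-∏≈falling : ∀ (p : ℕ → Poly) x y → (∀ i → eval (p i) x ≈ y - ι i) →
    ∀ n → eval (foldr _*ₚ_ 1ₚ (applyUpTo p n)) x ≈ falling y n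
  eval-∏≈falling p x y p≈ zero    = eval-const 1# x
  eval-∏≈falling p x y p≈ (suc n) = trans (eval-* (p 0) _ x)
    (*-cong (trans (p≈ 0) (x-0≈x y))
            (eval-∏≈falling (p ∘ suc) x (y - 1#)
              (λ i → trans (p≈ (suc i)) (y-ι[1+n]≈y-1-ιn y i)) n))

  -- Reciprocals of factorials.

  factorial⁻¹-inverse : ∀ n → factorial⁻¹ n * ι (n !) ≈ 1#
  -- The apartness `x # 0#` provides an inverse of the difference `x - 0#`, not of `x` itself.
  factorial⁻¹-inverse n = trans (*-congˡ (sym (x-0≈x (ι (n !)))))
    (proj₁ (proj₂ (#⇒invertible (char0 (n !) {{n ℕₚ.!≢0}}))))

  -- Brings basis values of degrees n and n + 1 to the common factor 1/(n + 1)!.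
  factorial⁻¹-suc : ∀ n → factorial⁻¹ n ≈ factorial⁻¹ (suc n) * ι (suc n)
  factorial⁻¹-suc n = begin
    f                            ≈⟨ *-identityˡ f ⟨
    1# * f                       ≈⟨ *-congʳ (factorial⁻¹-inverse (suc n)) ⟨
    g * ι (suc n !) * f          ≈⟨ *-congʳ (*-congˡ (×1-homo-* (suc n) (n !))) ⟩
    g * (ι (suc n) * ι (n !)) * f
      ≈⟨ solve 4 (λ g s t f → g :* (s :* t) :* f := g :* s :* (f :* t)) refl g (ι (suc n)) (ι (n !)) f ⟩
    g * ι (suc n) * (f * ι (n !))  ≈⟨ *-congˡ (factorial⁻¹-inverse n) ⟩
    g * ι (suc n) * 1#           ≈⟨ *-identityʳ _ ⟩
    g * ι (suc n)                ∎
    where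
    f = factorial⁻¹ n
    g = factorial⁻¹ (suc n)

  -- Values of the basis polynomials.

  arg : ℕ → ℕ → Carrier → Carrier
  arg n k x = x + (ι n - ι k - 1#)

  basisValue : ℕ → ℕ → Carrier → Carrier
  basisValue n k x = factorial⁻¹ n * falling (arg n k x) n

  eval-basis : ∀ n k x → eval (basis n k) x ≈ basisValue n k x
  eval-basis n k x = trans (eval-• (factorial⁻¹ n) (foldr _*ₚ_ 1ₚ (applyUpTo factor n)) x)
    (*-congˡ (eval-∏≈falling factor x (arg n k x) eval-factor n))
    where
    Y : Poly
    Y = X +ₚ const (ι n - ι k - 1#)

    factor : ℕ → Poly
    factor i = Y +ₚ const (- ι i)

    eval-factor : ∀ i → eval (factor i) x ≈ arg n k x - ι i
    eval-factor i = trans (eval-+ Y (const (- ι i)) x)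
      (+-cong (trans (eval-+ X (const _) x) (+-cong (eval-X x) (eval-const _ x)))
              (eval-const (- ι i) x))

  eval-eulerian : ∀ Q A → IsEulerian Q A → ∀ n x →
    eval (poly Q n) x ≈ ∑[ k < suc n ] (A n (toℕ k) * basisValue n (toℕ k) x)
  eval-eulerian Q A isA n x = begin
    eval (poly Q n) x  ≈⟨ eval-cong (poly Q n) (foldr _+ₚ_ 0ₚ (applyUpTo (λ k → A n k • basis n k) (suc n))) x (isA n) ⟩
    _                  ≈⟨ eval-∑ (λ k → A n k • basis n k) (suc n) x ⟩
    _                  ≈⟨ sum-cong-≋ {suc n} (λ k → trans (eval-• (A n (toℕ k)) (basis n (toℕ k)) x)
                                                   (*-congˡ (eval-basis n (toℕ k) x))) ⟩
    ∑[ k < suc n ] (A n (toℕ k) * basisValue n (toℕ k) x)  ∎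

  -- Writing n = k + d turns the argument x + n - k - 1 into x + d - 1. The 1 is moved to the left
  -- so that no subtraction remains on the right; it is cancelled again where argument values are
  -- compared.
  arg+1 : ∀ k d x → arg (k ℕ.+ d) k x + 1# ≈ x + ι d
  arg+1 k d x = begin
    x + (ι (k ℕ.+ d) - ι k - 1#) + 1#
      ≈⟨ +-congʳ (+-congˡ (+-congʳ (+-congʳ (trans (ι-+ k d) (+-comm (ι k) (ι d)))))) ⟩
    x + (ι d + ι k - ι k - 1#) + 1#  ≈⟨ +-assoc x _ _ ⟩
    x + (ι d + ι k - ι k - 1# + 1#)  ≈⟨ +-congˡ (//-rightDividesˡ 1# _) ⟩
    x + (ι d + ι k - ι k)            ≈⟨ +-congˡ (//-rightDividesʳ (ι k) (ι d)) ⟩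
    x + ι d                          ∎

  arg-sucˡ : ∀ n k x → arg (suc n) k x ≈ arg n k x + 1#
  arg-sucˡ n k x =
    solve 4 (λ x n k o → x :+ (con 1 :+ n :+ k :+ o) := x :+ (n :+ k :+ o) :+ con 1)
      refl x (ι n) (- ι k) (- 1#)

  arg-suc² : ∀ k d x → arg (suc (k ℕ.+ d)) (suc k) x ≈ arg (k ℕ.+ d) k x
  arg-suc² k d x = +-cancelʳ 1# _ _ (trans (arg+1 (suc k) d x) (sym (arg+1 k d x)))

  arg-ι : ∀ k d j → arg (k ℕ.+ d) k (ι (suc j)) ≈ ι (j ℕ.+ d)
  arg-ι k d j = +-cancelʳ 1# _ _ (begin
    arg (k ℕ.+ d) k (ι (suc j)) + 1#  ≈⟨ arg+1 k d (ι (suc j)) ⟩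
    ι (suc j) + ι d                   ≈⟨ ι-+ (suc j) d ⟨
    1# + ι (j ℕ.+ d)                  ≈⟨ +-comm _ _ ⟩
    ι (j ℕ.+ d) + 1#                  ∎)

  -- With n = k + d, the argument at the point k + 1 is k + d = n, and binom(n, n) = 1.
  basisValue-diag : ∀ {n k} → k ≤ n → basisValue n k (ι (suc k)) ≈ 1#
  basisValue-diag {k = k} k≤n with ℕₚ.m≤n⇒∃[o]m+o≡n k≤n
  ... | d , ≡.refl = begin
    factorial⁻¹ n * falling (arg n k (ι (suc k))) n  ≈⟨ *-congˡ (falling-cong n (arg-ι k d k)) ⟩
    factorial⁻¹ n * falling (ι n) n                  ≈⟨ *-congˡ (falling-ι-diag n) ⟩
    factorial⁻¹ n * ι (n !)                       ≈⟨ factorial⁻¹-inverse n ⟩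
    1#                                            ∎
    where n = k ℕ.+ d

  -- With n = k + d, the argument at the point j + 1 is the natural number j + d < n, so binom(j +
  -- d, n) = 0.
  basisValue-vanish : ∀ {n j k} → j < k → k ≤ n → basisValue n k (ι (suc j)) ≈ 0#
  basisValue-vanish {j = j} {k} j<k k≤n with ℕₚ.m≤n⇒∃[o]m+o≡n k≤n
  ... | d , ≡.refl = begin
    factorial⁻¹ n * falling (arg n k (ι (suc j))) n  ≈⟨ *-congˡ (falling-cong n (arg-ι k d j)) ⟩
    factorial⁻¹ n * falling (ι (j ℕ.+ d)) n          ≈⟨ *-congˡ (falling-ι-vanish (ℕₚ.+-monoˡ-< d j<k)) ⟩
    factorial⁻¹ n * 0#                            ≈⟨ zeroʳ _ ⟩
    0#                                            ∎
    where n = k ℕ.+ d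

  -- Multiplication of a basis polynomial by x.

  falling-recurrence : ∀ k d {x y} → y + 1# ≈ x + ι d → let m = k ℕ.+ d in
    ι (suc m) * (x * falling y m) ≈ ι (suc k) * falling (x + ι d) (suc m) + ι d * falling y (suc m)
  -- With z = y - m, so x = z + k + 1, this is a semiring identity.
  falling-recurrence k d {x} {y} y+1≈x+d = begin
    ι (suc m) * (x * f)
      ≈⟨ *-cong (+-congˡ (ι-+ k d)) (*-congʳ x≈z+1+k) ⟩
    (1# + (ι k + ι d)) * ((z + ι (suc k)) * f)
      ≈⟨ solve 4 (λ k d z f →
             (con 1 :+ (k :+ d)) :* ((z :+ (con 1 :+ k)) :* f)
               := (con 1 :+ k) :* ((z :+ (con 1 :+ k) :+ d) :* f) :+ d :* (f :* z))
           refl (ι k) (ι d) z f ⟩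
    ι (suc k) * ((z + ι (suc k) + ι d) * f) + ι d * (f * z)
      ≈⟨ +-cong (*-congˡ (*-cong (+-congʳ (sym x≈z+1+k)) (falling-cong m y≈x+d-1)))
                (*-congˡ (sym (falling-snoc y m))) ⟩
    ι (suc k) * falling (x + ι d) (suc m) + ι d * falling y (suc m)  ∎
    where
    m = k ℕ.+ d
    f = falling y m
    z = y - ι m

    y≈x+d-1 : y ≈ x + ι d - 1#
    y≈x+d-1 = trans (sym (//-rightDividesʳ 1# y)) (+-congʳ y+1≈x+d)

    x≈z+1+k : x ≈ z + ι (suc k)
    x≈z+1+k = +-cancelʳ (ι d) _ _ (begin
      x + ι d                  ≈⟨ y+1≈x+d ⟨
      y + 1#                   ≈⟨ +-congʳ (//-rightDividesˡ (ι m) y) ⟨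
      z + ι m + 1#             ≈⟨ +-congʳ (+-congˡ (ι-+ k d)) ⟩
      z + (ι k + ι d) + 1#
        ≈⟨ solve 3 (λ z k d → z :+ (k :+ d) :+ con 1 := z :+ (con 1 :+ k) :+ d) refl z (ι k) (ι d) ⟩
      z + ι (suc k) + ι d      ∎)

  -- Writing m = k + d turns `m ∸ k` into `d`; once 1/(m + 1)! is factored out, the identity is
  -- `falling-recurrence`.
  basisValue-recurrence : ∀ {m k} x → k ≤ m →
    x * basisValue m k x
      ≈ ι (suc k) * basisValue (suc m) k x + ι (m ∸ k) * basisValue (suc m) (suc k) x
  basisValue-recurrence {k = k} x k≤m with ℕₚ.m≤n⇒∃[o]m+o≡n k≤m
  ... | d , ≡.refl rewrite ℕₚ.m+n∸m≡n k d = begin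
    x * (factorial⁻¹ m * falling y m)
      ≈⟨ *-congˡ (*-congʳ (factorial⁻¹-suc m)) ⟩
    x * (g * ι (suc m) * falling y m)
      ≈⟨ solve 4 (λ x g s f → x :* (g :* s :* f) := g :* (s :* (x :* f))) refl x g (ι (suc m)) (falling y m) ⟩
    g * (ι (suc m) * (x * falling y m))
      ≈⟨ *-congˡ (falling-recurrence k d (arg+1 k d x)) ⟩
    g * (ι (suc k) * falling (x + ι d) (suc m) + ι d * falling y (suc m))
      -- Raising only the degree raises the argument by 1, to x + d; raising degree and index
      -- together leaves it equal to y.
      ≈⟨ *-congˡ (+-cong (*-congˡ (falling-cong (suc m) (sym (trans (arg-sucˡ m k x) (arg+1 k d x)))))
                         (*-congˡ (falling-cong (suc m) (sym (arg-suc² k d x))))) ⟩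
    g * (ι (suc k) * falling (arg (suc m) k x) (suc m) + ι d * falling (arg (suc m) (suc k) x) (suc m))
      ≈⟨ solve 5 (λ g s u d v → g :* (s :* u :+ d :* v) := s :* (g :* u) :+ d :* (g :* v))
           refl g (ι (suc k)) (falling (arg (suc m) k x) (suc m)) (ι d) (falling (arg (suc m) (suc k) x) (suc m)) ⟩
    ι (suc k) * basisValue (suc m) k x + ι d * basisValue (suc m) (suc k) x  ∎
    where
    m = k ℕ.+ d
    y = arg m k x
    g = factorial⁻¹ (suc m)

  -- Unitriangular systems and the first coefficient.

  -- The first row of a unitriangular system. It starts the elimination below and also reads off
  -- A_{n,0} from the value at 1.
  ∑-first : ∀ n (u b : ℕ → Carrier) → b 0 ≈ 1# → (∀ k → k < n → b (suc k) ≈ 0#) →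
    ∑[ k < suc n ] (u (toℕ k) * b (toℕ k)) ≈ u 0
  ∑-first n u b b₀≈1 b≈0 = begin
    u 0 * b 0 + ∑[ k < n ] (u (suc (toℕ k)) * b (suc (toℕ k)))
      ≈⟨ +-cong (trans (*-congˡ b₀≈1) (*-identityʳ _))
                (trans (sum-cong-≋ {n} (λ k → trans (*-congˡ (b≈0 (toℕ k) (toℕ<n k))) (zeroʳ _)))
                       (sum-replicate-zero n)) ⟩
    u 0 + 0#  ≈⟨ +-identityʳ _ ⟩
    u 0       ∎

  -- Forward substitution: the first row determines the first unknown, and the remaining rows form a
  -- smaller system of the same shape, with the first row and column removed.
  unitriangular-injective : ∀ n (M : ℕ → ℕ → Carrier) →
    (∀ j → j < n → M j j ≈ 1#) →
    (∀ j k → j < k → k < n → M j k ≈ 0#) →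
    (u v : ℕ → Carrier) →
    (∀ j → j < n → ∑[ k < n ] (u (toℕ k) * M j (toℕ k)) ≈ ∑[ k < n ] (v (toℕ k) * M j (toℕ k))) →
    ∀ k → k < n → u k ≈ v k
  unitriangular-injective (suc n) M diag upper u v Mu≈Mv = λ
    { zero    _   → u₀≈v₀
    ; (suc k) k<n → unitriangular-injective n (λ i j → M (suc i) (suc j))
      (λ j j<n → diag (suc j) (s<s j<n))
      (λ i j i<j j<n → upper (suc i) (suc j) (s<s i<j) (s<s j<n))
      (u ∘ suc) (v ∘ suc)
      -- As `u 0 ≈ v 0`, the first column contributes equally to both sides and cancels.
      (λ j j<n → +-cancelˡ (u 0 * M (suc j) 0) _ _
        (trans (Mu≈Mv (suc j) (s<s j<n)) (+-congʳ (*-congʳ (sym u₀≈v₀)))))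
      k (s<s⁻¹ k<n)
    }
    where
    first : ∀ w → ∑[ k < suc n ] (w (toℕ k) * M 0 (toℕ k)) ≈ w 0
    first w = ∑-first n w (M 0) (diag 0 z<s) (λ k k<n → upper 0 (suc k) z<s (s<s k<n))

    u₀≈v₀ : u 0 ≈ v 0
    u₀≈v₀ = trans (sym (first u)) (trans (Mu≈Mv 0 z<s) (first v))

  eulerian-first : ∀ Q A → IsEulerian Q A → ∀ n → A n 0 ≈ eval (poly Q n) 1#
  eulerian-first Q A isA n = begin
    A n 0
      ≈⟨ ∑-first n (A n) (λ k → basisValue n k (ι 1)) (basisValue-diag {n} z≤n)
           (λ k k<n → basisValue-vanish z<s k<n) ⟨
    ∑[ k < suc n ] (A n (toℕ k) * basisValue n (toℕ k) (ι 1))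
      ≈⟨ eval-eulerian Q A isA n (ι 1) ⟨
    -- `ι 1` unfolds to `1# + 0#`, so it equals `1#` only up to `_≈_`.
    eval (poly Q n) (ι 1)  ≈⟨ eval-congʳ (poly Q n) (×-homo-1 1#) ⟩
    eval (poly Q n) 1#     ∎

  -- Eulerian numbers of the sequence x p_{n-1}(x).

  eval-bar : ∀ P m x → eval (poly (bar P) (suc m)) x ≈ x * eval (poly P m) x
  eval-bar P m x = trans (eval-* X (poly P m) x) (*-congʳ (eval-X x))

  -- Collects the contributions to B (m + 1) k in x p_m: the factor k + 1 comes from B m k, the
  -- factor m - (k - 1) from B m (k - 1). The factor `ι 1` is kept so that the first summand has one
  -- shape in both clauses.
  barCoeff : (ℕ → ℕ → Carrier) → ℕ → ℕ → Carrier
  barCoeff A m zero    = ι 1 * A m 0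
  barCoeff A m (suc k) = ι (suc (suc k)) * A m (suc k) + ι (m ∸ k) * A m k

  -- There is no term k = m + 1: its coefficient would be (m - m) A m m = 0.
  eval-bar-expansion : ∀ P A → IsEulerian P A → ∀ m x →
    eval (poly (bar P) (suc m)) x
      ≈ ∑[ k < suc m ] (barCoeff A m (toℕ k) * basisValue (suc m) (toℕ k) x)
  eval-bar-expansion P A isA m x = begin
    eval (poly (bar P) (suc m)) x   ≈⟨ eval-bar P m x ⟩
    x * eval (poly P m) x           ≈⟨ *-congˡ (eval-eulerian P A isA m x) ⟩
    x * ∑[ k < suc m ] (A m (toℕ k) * basisValue m (toℕ k) x)
      ≈⟨ *-distribˡ-sum {suc m} x (λ k → A m (toℕ k) * basisValue m (toℕ k) x) ⟩
    ∑[ k < suc m ] (x * (A m (toℕ k) * basisValue m (toℕ k) x))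
      ≈⟨ sum-cong-≋ {suc m} (λ k → expand (toℕ k) (s≤s⁻¹ (toℕ<n k))) ⟩
    ∑[ k < suc m ] (f (toℕ k) * b (toℕ k) + g (toℕ k) * b (suc (toℕ k)))
      ≈⟨ ∑-distrib-+ {suc m} (λ k → f (toℕ k) * b (toℕ k)) (λ k → g (toℕ k) * b (suc (toℕ k))) ⟩
    -- The first sum unfolds to its term k = 0 plus `F⁺`. The second is already indexed by the basis
    -- element k + 1, so without its last term it merges with `F⁺`.
    f 0 * b 0 + F⁺ + ∑[ k < suc m ] (g (toℕ k) * b (suc (toℕ k)))
      ≈⟨ +-congˡ (trans (∑-snoc m (λ k → g k * b (suc k))) (+-congˡ g[m]b≈0)) ⟩
    f 0 * b 0 + F⁺ + (G + 0#)
      ≈⟨ trans (+-congˡ (+-identityʳ G)) (+-assoc _ F⁺ G) ⟩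
    f 0 * b 0 + (F⁺ + G)
      ≈⟨ +-congˡ (∑-distrib-+ {m} (λ k → f (suc (toℕ k)) * b (suc (toℕ k))) (λ k → g (toℕ k) * b (suc (toℕ k)))) ⟨
    f 0 * b 0 + ∑[ k < m ] (f (suc (toℕ k)) * b (suc (toℕ k)) + g (toℕ k) * b (suc (toℕ k)))
      ≈⟨ +-congˡ (sum-cong-≋ {m} (λ k → sym (distribʳ (b (suc (toℕ k))) (f (suc (toℕ k))) (g (toℕ k))))) ⟩
    ∑[ k < suc m ] (barCoeff A m (toℕ k) * b (toℕ k))  ∎
    where
    b f g : ℕ → Carrier
    b k = basisValue (suc m) k x
    f k = ι (suc k) * A m k
    g k = ι (m ∸ k) * A m k

    F⁺ G : Carrier
    F⁺ = ∑[ k < m ] (f (suc (toℕ k)) * b (suc (toℕ k)))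
    G  = ∑[ k < m ] (g (toℕ k) * b (suc (toℕ k)))

    expand : ∀ k → k ≤ m → x * (A m k * basisValue m k x) ≈ f k * b k + g k * b (suc k)
    expand k k≤m = begin
      x * (A m k * basisValue m k x)
        ≈⟨ solve 3 (λ x a v → x :* (a :* v) := a :* (x :* v)) refl x (A m k) (basisValue m k x) ⟩
      A m k * (x * basisValue m k x)
        ≈⟨ *-congˡ (basisValue-recurrence x k≤m) ⟩
      A m k * (ι (suc k) * b k + ι (m ∸ k) * b (suc k))
        ≈⟨ solve 5 (λ a s u d v → a :* (s :* u :+ d :* v) := s :* a :* u :+ d :* a :* v)
             refl (A m k) (ι (suc k)) (b k) (ι (m ∸ k)) (b (suc k)) ⟩
      f k * b k + g k * b (suc k)  ∎

    g[m]b≈0 : g m * b (suc m) ≈ 0#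
    g[m]b≈0 = begin
      ι (m ∸ m) * A m m * b (suc m)  ≡⟨ ≡.cong (λ i → ι i * A m m * b (suc m)) (ℕₚ.n∸n≡0 m) ⟩
      0# * A m m * b (suc m)         ≈⟨ trans (*-congʳ (zeroˡ _)) (zeroˡ _) ⟩
      0#                             ∎

  -- Both families expand x p_m, but that of `Ā` has an extra entry k = m + 1. Only the points 1,
  -- ..., m + 1 are used, where B (m + 1) (m + 1) vanishes, so a square system for the entries k ≤ m
  -- remains.
  bar-recurrence : ∀ P A Ā → IsEulerian P A → IsEulerian (bar P) Ā →
    ∀ m k → k ≤ m → Ā (suc m) k ≈ barCoeff A m k
  bar-recurrence P A Ā isA isĀ m k k≤m =
    unitriangular-injective (suc m) (λ j k → basisValue (suc m) k (ι (suc j)))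
      (λ j j<1+m → basisValue-diag (ℕₚ.<⇒≤ j<1+m))
      (λ j k j<k k<1+m → basisValue-vanish j<k (ℕₚ.<⇒≤ k<1+m))
      (Ā (suc m)) (barCoeff A m) row k (s≤s k≤m)
    where
    row : ∀ j → j < suc m →
      ∑[ k < suc m ] (Ā (suc m) (toℕ k) * basisValue (suc m) (toℕ k) (ι (suc j)))
        ≈ ∑[ k < suc m ] (barCoeff A m (toℕ k) * basisValue (suc m) (toℕ k) (ι (suc j)))
    row j j<1+m = begin
      S                                  ≈⟨ +-identityʳ S ⟨
      S + 0#                             ≈⟨ +-congˡ (trans (*-congˡ (basisValue-vanish j<1+m ℕₚ.≤-refl)) (zeroʳ _)) ⟨
      S + Ā (suc m) (suc m) * b (suc m)  ≈⟨ ∑-snoc (suc m) (λ k → Ā (suc m) k * b k) ⟨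
      ∑[ k < suc (suc m) ] (Ā (suc m) (toℕ k) * b (toℕ k))
        ≈⟨ eval-eulerian (bar P) Ā isĀ (suc m) (ι (suc j)) ⟨
      eval (poly (bar P) (suc m)) (ι (suc j))
        ≈⟨ eval-bar-expansion P A isA m (ι (suc j)) ⟩
      ∑[ k < suc m ] (barCoeff A m (toℕ k) * b (toℕ k))  ∎
      where
      b : ℕ → Carrier
      b k = basisValue (suc m) k (ι (suc j))
      S = ∑[ k < suc m ] (Ā (suc m) (toℕ k) * b (toℕ k))

theorem3p3 :
    ∀ {c ℓ₁ ℓ₂} (F : HeytingField c ℓ₁ ℓ₂) (char0 : CharacteristicZero F) →
    let open HeytingField F
        open Eulerian F char0
    in
    (P : PolynomialSequence) (A Ā : ℕ → ℕ → Carrier) →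
    IsEulerian P A → IsEulerian (bar P) Ā →
    (∀ n k → 2 ≤ n → 1 ≤ k → k ≤ n ∸ 1 →
      Ā n k ≈ ι (suc k) * A (n ∸ 1) k + ι (n ∸ k) * A (n ∸ 1) (k ∸ 1))
    ×
    (∀ n → 1 ≤ n →
      (Ā n 0 ≈ eval (poly (bar P) n) 1#) ×
      (eval (poly (bar P) n) 1# ≈ A (n ∸ 1) 0) ×
      (A (n ∸ 1) 0 ≈ eval (poly P (n ∸ 1)) 1#))
theorem3p3 F char0 P A Ā isA isĀ =
  -- With both indices successors, `n ∸ k` reduces to `m ∸ k`, and the claimed right-hand side is
  -- `barCoeff A m (suc k)` by definition.
  (λ where (suc m) (suc k) _ _ k<m → bar-recurrence F char0 P A Ā isA isĀ m (suc k) k<m) ,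
  (λ where
    (suc m) _ →
      eulerian-first F char0 (bar P) Ā isĀ (suc m) ,
      trans (eval-bar F char0 P m 1#)
        (trans (*-identityˡ _) (sym (eulerian-first F char0 P A isA m))) ,
      eulerian-first F char0 P A isA m)
  where
  open HeytingField F
  open Eulerian F char0
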